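{- Let $\mathcal{L}$ be a propositional language and let $\mathcal{M}=\{\mathbf{M}_i\}_{i\in I}$ be a uniform bundle of $\mathcal{L}$-matrices. Then the $\mathcal{M}$-consequence $\vdash_{\mathcal{M}}$ is uniform.
   Context: $\mathcal{L}$ is an abstract propositional language, given by a set $\mathcal{V}_{\mathcal{L}}$ of variables, a set of constants and a set of finitary connectives. $\mathbf{Fm}_{\mathcal{L}}$ is the set of all $\mathcal{L}$-formulae; $\mathcal{V}(\alpha)$ is the set of variables occurring in $\alpha$, and $\mathcal{V}(X)=\bigcup_{\alpha\in X}\mathcal{V}(\alpha)$ for $X\subseteq\mathbf{Fm}_{\mathcal{L}}$. For $\mathcal{V}\subseteq\mathcal{V}_{\mathcal{L}}$, $\mathbf{Fm}_{\mathcal{L}}[\mathcal{V}]=\{\alpha\in\mathbf{Fm}_{\mathcal{L}} : \mathcal{V}(\alpha)\subseteq\mathcal{V}\}$. An $\mathcal{L}$-matrix is a pair $\mathbf{M}=\langle\mathbf{A},D\rangle$ with $\mathbf{A}$ an algebra of the signature of $\mathcal{L}$ and $D\subseteq|\mathbf{A}|$ (its logical filter). $X\models_{\mathbf{M}}\alpha$ means: for every valuation $v$ in $\mathbf{A}$ (homomorphism from the formula algebra to $\mathbf{A}$), if $v[X]\subseteq D$ then $v[\alpha]\in D$. For a nonempty family $\mathcal{M}=\{\mathbf{M}_i\}_{i\in I}$, the $\mathcal{M}$-consequence is defined by: $X\vdash_{\mathcal{M}}\alpha$ iff $X\models_{\mathbf{M}_i}\alpha$ for each $i\in I$. A nonempty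 family $\{\langle\mathbf{A}_i,D_i\rangle\}_{i\in I}$ of $\mathcal{L}$-matrices is a bundle if the algebras $\mathbf{A}_i$ are pairwise isomorphic. For an $\mathcal{L}$-matrix $\mathbf{M}=\langle\mathbf{A},D\rangle$, $\mathfrak{S}(\mathbf{M})$ is the set of all $X\subseteq\mathbf{Fm}_{\mathcal{L}}$ such that $X=\{\alpha\in\mathbf{Fm}_{\mathcal{L}} : v[\alpha]\in D\}$ for some valuation $v$ in $\mathbf{A}$. A bundle $\{\mathbf{M}_i\}_{i\in I}$ is uniform if for all $X,Y\subseteq\mathbf{Fm}_{\mathcal{L}}$ with $X\subseteq\mathbf{Fm}_{\mathcal{L}}[\mathcal{V}_{\mathcal{L}}\setminus\mathcal{V}(Y)]$, all $i,j\in I$, all $Z_i\in\mathfrak{S}(\mathbf{M}_i)$ and $Z_j\in\mathfrak{S}(\mathbf{M}_j)$, there are $k\in I$ and $Z_k\in\mathfrak{S}(\mathbf{M}_k)$ such that: if $X\subseteq Z_i$ and $Y\subseteq Z_j\subsetneq\mathbf{Fm}_{\mathcal{L}}$, then $Z_i\cap\mathbf{Fm}_{\mathcal{L}}[\mathcal{V}_{\mathcal{L}}\setminus\mathcal{V}(Y)]=Z_k\cap\mathbf{Fm}_{\mathcal{L}}[\mathcal{V}_{\mathcal{L}}\setminus\mathcal{V}(Y)]$ and $Z_j\cap\mathbf{Fm}_{\mathcal{L}}[\mathcal{V}(Y)]\subseteq Z_k$. A consequence relation $\vdash$ in $\mathcal{L}$ is uniform if for all $X,Y\subseteq\mathbf{Fm}_{\mathcal{L}}$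 and $\alpha\in\mathbf{Fm}_{\mathcal{L}}$ such that $\mathcal{V}(X\cup\{\alpha\})\cap\mathcal{V}(Y)=\varnothing$ and $Y$ is consistent (i.e. $Y\not\vdash\beta$ for some $\beta\in\mathbf{Fm}_{\mathcal{L}}$): $X\cup Y\vdash\alpha$ implies $X\vdash\alpha$. -}

module Defs where

open import Data.Nat using (ℕ)
open import Data.Product using (Σ; Σ-syntax; ∃-syntax; _×_; proj₁)
open import Data.Vec using (Vec; map)
open import Data.Vec.Relation.Unary.Any using (Any)
open import Function.Definitions using (Bijective)
open import Level using (Level; suc)
open import Relation.Binary.PropositionalEquality using (_≡_)
open import Relation.Nullary using (¬_)
open import Relation.Unary
  using (Pred; _∈_; _⊆_; _⊂_; _≐_; _∩_; _∪_; ∁; U; Empty; ｛_｝)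

-- All carriers and index sets live in Set ℓ, and a subset of A is a predicate
-- A → Set ℓ, for one arbitrary level ℓ. Subsets are compared extensionally
-- (_≐_).

record Language (ℓ : Level) : Set (suc ℓ) where
  field
    Var   : Set ℓ
    Const : Set ℓ
    Conn  : Set ℓ
    arity : Conn → ℕ

module _ {ℓ : Level} (L : Language ℓ) where
  open Language L

  record Algebra : Set (suc ℓ) where
    field
      Carrier : Set ℓ
      const   : Const → Carrier
      op      : (c : Conn) → Vec Carrier (arity c) → Carrier

  record IsHom (A B : Algebra) (f : Algebra.Carrier A → Algebra.Carrier B) :
               Set ℓ where
    private
      module A = Algebra A
      module B = Algebra B
    field
      const-homo : ∀ c → f (A.const c) ≡ B.const c
      op-homo    : ∀ c as → f (A.op c as) ≡ B.op c (map f as)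

  Hom : Algebra → Algebra → Set ℓ
  Hom A B = Σ (Algebra.Carrier A → Algebra.Carrier B) (IsHom A B)

  Isomorphic : Algebra → Algebra → Set ℓ
  Isomorphic A B =
    Σ[ f ∈ (Algebra.Carrier A → Algebra.Carrier B) ]
      IsHom A B f × Bijective _≡_ _≡_ f

  data Fm : Set ℓ where
    var   : Var → Fm
    const : Const → Fm
    app   : (c : Conn) → Vec Fm (arity c) → Fm

  FmAlgebra : Algebra
  FmAlgebra = record { Carrier = Fm ; const = const ; op = app }

  data Occurs (p : Var) : Fm → Set ℓ where
    here  : Occurs p (var p)
    there : ∀ {c αs} → Any (Occurs p) αs → Occurs p (app c αs)

  𝒱 : Fm → Pred Var ℓ
  𝒱 α p = Occurs p α

  𝒱ₛ : Pred Fm ℓ → Pred Var ℓ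
  𝒱ₛ X p = ∃[ α ] α ∈ X × p ∈ 𝒱 α

  Fm[_] : Pred Var ℓ → Pred Fm ℓ
  Fm[ W ] α = 𝒱 α ⊆ W

  record Matrix : Set (suc ℓ) where
    field
      algebra : Algebra
      D       : Pred (Algebra.Carrier algebra) ℓ

    Valuation : Set ℓ
    Valuation = Hom FmAlgebra algebra

    designated : Valuation → Pred Fm ℓ
    designated v α = proj₁ v α ∈ D

  infix 4 _⊨⟨_⟩_

  _⊨⟨_⟩_ : Pred Fm ℓ → Matrix → Fm → Set ℓ
  X ⊨⟨ M ⟩ α = (v : Valuation) → X ⊆ designated v → α ∈ designated v
    where open Matrix M

  Consequence : {I : Set ℓ} → (I → Matrix) → Pred Fm ℓ → Fm → Set ℓ
  Consequence M X α = ∀ i → X ⊨⟨ M i ⟩ α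

  record IsBundle {I : Set ℓ} (M : I → Matrix) : Set ℓ where
    field
      nonempty   : I
      isomorphic : ∀ i j → Isomorphic (Matrix.algebra (M i)) (Matrix.algebra (M j))

  𝔖 : Matrix → Pred (Pred Fm ℓ) ℓ
  𝔖 M X = Σ[ v ∈ Matrix.Valuation M ] X ≐ Matrix.designated M v

  IsUniformFamily : {I : Set ℓ} → (I → Matrix) → Set (suc ℓ)
  IsUniformFamily {I} M =
    (X Y : Pred Fm ℓ) → X ⊆ Fm[ ∁ (𝒱ₛ Y) ] →
    (i j : I) (Zᵢ Zⱼ : Pred Fm ℓ) → Zᵢ ∈ 𝔖 (M i) → Zⱼ ∈ 𝔖 (M j) →
    Σ[ k ∈ I ] Σ[ Zₖ ∈ Pred Fm ℓ ] Zₖ ∈ 𝔖 (M k) ×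
      (X ⊆ Zᵢ → Y ⊆ Zⱼ → Zⱼ ⊂ U →
        (Zᵢ ∩ Fm[ ∁ (𝒱ₛ Y) ] ≐ Zₖ ∩ Fm[ ∁ (𝒱ₛ Y) ]) ×
        (Zⱼ ∩ Fm[ 𝒱ₛ Y ] ⊆ Zₖ))

  record IsUniformBundle {I : Set ℓ} (M : I → Matrix) : Set (suc ℓ) where
    field
      isBundle : IsBundle M
      uniform  : IsUniformFamily M

  Consistent : (Pred Fm ℓ → Fm → Set ℓ) → Pred Fm ℓ → Set ℓ
  Consistent _⊢_ Y = ∃[ β ] ¬ (Y ⊢ β)

  IsUniformConsequence : (Pred Fm ℓ → Fm → Set ℓ) → Set (suc ℓ)
  IsUniformConsequence _⊢_ =
    (X Y : Pred Fm ℓ) (α : Fm) →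
    Empty (𝒱ₛ (X ∪ ｛ α ｝) ∩ 𝒱ₛ Y) → Consistent _⊢_ Y →
    (X ∪ Y) ⊢ α → X ⊢ α

{-# OPTIONS --safe #-}
module Submission where

open import Defs
open import Axiom.ExcludedMiddle using (ExcludedMiddle)
open import Data.Product using (_,_; proj₁; proj₂)
open import Data.Sum using (inj₁; inj₂; [_,_])
open import Level using (Level)
open import Relation.Binary.PropositionalEquality using (refl)
open import Relation.Nullary.Decidable using (decidable-stable)
open import Relation.Unary using (Pred; _∈_; _∉_; _⊆_; Empty; ∁; _∩_; _∪_; ｛_｝)

-- Let v validate X in Mᵢ, and let w validate Y but not some β in Mⱼ. Uniformity
-- merges their theories into one Z that agrees with that of v off the variables
-- of Y and contains that of w on them. So Z contains X ∪ Y, hence α, and α has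
-- no variable of Y, so v designates α already.

module _ {ℓ : Level} (L : Language ℓ) {I : Set ℓ} (M : I → Matrix L)
         (uniform : IsUniformFamily L M) where

  merge : (X Y : Pred (Fm L) ℓ) (α : Fm L) →
    Empty (𝒱ₛ L (X ∪ ｛ α ｝) ∩ 𝒱ₛ L Y) → Consequence L M (X ∪ Y) α →
    ∀ {i j} (v : Matrix.Valuation (M i)) (w : Matrix.Valuation (M j)) {β} →
    X ⊆ Matrix.designated (M i) v → Y ⊆ Matrix.designated (M j) w →
    β ∉ Matrix.designated (M j) w → α ∈ Matrix.designated (M i) v
  merge X Y α disjoint X∪Y⊢α {i} {j} v w {β} X⊆v Y⊆w β∉w
    with uniform X Y (λ φ∈X p∈φ p∈Y → disjoint _ ((_ , inj₁ φ∈X , p∈φ) , p∈Y)) i j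
           (Matrix.designated (M i) v) (Matrix.designated (M j) w)
           (v , (λ z → z) , λ z → z) (w , (λ z → z) , λ z → z)
  ... | k , Z , (u , Z⊆u , u⊆Z) , merged
    -- `β` witnesses that the theory of `w` is a proper subset of `U`.
    with merged X⊆v Y⊆w (_ , λ U⊆w → β∉w (U⊆w _))
  ... | (v⊆Z , Z⊆v) , w⊆Z = proj₁ (Z⊆v (u⊆Z (X∪Y⊢α k u X∪Y⊆u) , off (inj₂ refl)))
    where
    off : X ∪ ｛ α ｝ ⊆ Fm[_] L (∁ (𝒱ₛ L Y))
    off φ∈ p∈φ p∈Y = disjoint _ ((_ , φ∈ , p∈φ) , p∈Y)

    X∪Y⊆u : X ∪ Y ⊆ Matrix.designated (M k) u
    X∪Y⊆u = [ (λ φ∈X → Z⊆u (proj₁ (v⊆Z (X⊆v φ∈X , off (inj₁ φ∈X)))))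
            -- A member of `Y` has all its variables in `𝒱ₛ L Y`, so `w⊆Z` applies to it.
            , (λ φ∈Y → Z⊆u (w⊆Z (Y⊆w φ∈Y , λ p∈φ → _ , φ∈Y , p∈φ))) ]

proposition2p1 : ∀ {ℓ : Level} → ExcludedMiddle ℓ →
    (L : Language ℓ) {I : Set ℓ} (M : I → Matrix L) →
    IsUniformBundle L M → IsUniformConsequence L (Consequence L M)
proposition2p1 em L M bundle X Y α disjoint (β , Y⊬β) X∪Y⊢α i v X⊆v =
  -- Consistency only refutes `Y ⊢ β` and supplies no countermodel `w`. So argue by contradiction:
  -- if `v` did not designate `α`, then by `merge` no `w` validating `Y` could miss `β`, and `Y ⊢ β`
  -- would hold.
  decidable-stable em λ α∉v → Y⊬β λ j w Y⊆w →
    decidable-stable em λ β∉w →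
      α∉v (merge L M (IsUniformBundle.uniform bundle) X Y α disjoint X∪Y⊢α v w X⊆v Y⊆w β∉w)
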